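{- Let $\kappa\geq\aleph_1$ and let $\Omega$ be a complete semiring. The contraction $\mathcal{C}:\mathrm{Trisk}_\Omega(\mathbf{Set}_\kappa)\to\mathrm{Rel}_\Omega(\mathbf{Set}_\kappa)$ is a strict monoidal functor for both monoidal structures, i.e. $\mathcal{C}(T\otimes T')=\mathcal{C}(T)\otimes\mathcal{C}(T')$ and $\mathcal{C}(T\oplus T')=\mathcal{C}(T)\oplus\mathcal{C}(T')$ for all triskells $T,T'$.
   Context: $\mathbf{Set}_\kappa$ is the category of sets of cardinality less than $\kappa$. A complete semiring is a semiring in which sums of arbitrary families are defined. A triskell from $S$ to $T$ with weights in $\Omega$ (using its multiplicative monoid) is a tuple $(E,S,T,\Omega,s,t,w)$ with $s:E\to S$, $t:E\to T$, $w:E\to\Omega$. Composition of $(E,S,T,\Omega,s,t,w)$ and $(E',T,T',\Omega,s',t',w')$ has edge set $\{(e,e')\in E\times E': t(e)=s'(e')\}$, source $s(e)$, target $t'(e')$, weight $w(e)w'(e')$; $\mathrm{Trisk}_\Omega(\mathbf{Set}_\kappa)$ has sets as objects and triskells up to isomorphism as morphisms. On triskells, $T\otimes T'=(E\times E',S\times S',T\times T',\Omega,s\times s',t\times t',(e,e')\mapsto w(e)w'(e'))$ and $T\oplus T'=(E+E',S+S',T+T',\Omega,s+s',t+t',(w,w'))$. $\mathrm{Rel}_\Omega(\mathbf{Set}_\kappa)$ has sets as objects, morphisms $A\to B$ the matrices $M=(m_{a,b})\in\Omega^{A\times B}$, composite of $M:A\to B$ and $N:B\to C$ given by $(a,c)\mapsto\sum_{b\in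 B}m_{a,b}n_{b,c}$, identity matrices as identities; $(M\otimes M')_{(a,a'),(b,b')}=m_{a,b}m'_{a',b'}$ and $M\oplus M'$ is the block-diagonal matrix on $(A+A')\times(B+B')$. The contraction functor $\mathcal{C}$ is the identity on objects and sends a triskell $T=(E,A,B,\Omega,s,t,w)$ to the matrix $\mathcal{C}(T)_{a,b}=\sum_{e\in E,\ s(e)=a,\ t(e)=b}w(e)$. -}

module Defs where

open import Algebra.Bundles using (Semiring)
open import Axiom.ExcludedMiddle using (ExcludedMiddle)
open import Axiom.Extensionality.Propositional using (Extensionality)
open import Axiom.UniquenessOfIdentityProofs.WithK using (uip)
open import Data.Bool.Base using (Bool; true; false; if_then_else_)
open import Data.Empty using (⊥-elim)
open import Data.Empty.Polymorphic using (⊥)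
open import Data.Nat.Base using (ℕ)
import Data.Nat.Properties as ℕ
open import Data.Product.Base as Prod using (Σ; Σ-syntax; _×_; _,_; proj₁; proj₂)
open import Data.Product.Function.NonDependent.Propositional using (_×-↔_)
open import Data.Sum.Base as Sum using (_⊎_; inj₁; inj₂; [_,_]; [_,_]′)
open import Data.Sum.Function.Propositional using (_⊎-↔_)
open import Data.Sum.Properties using (inj₁-injective; inj₂-injective)
open import Data.Unit.Polymorphic using (⊤)
open import Function.Base using (_∘_)
open import Function.Bundles using (_↣_; mk↣; Injection; _↔_; mk↔ₛ′; Inverse)
open import Function.Construct.Composition using (_↣-∘_; _↔-∘_)
open import Function.Construct.Identity using (↣-id; ↔-id)
open import Function.Construct.Symmetry using (↔-sym)
open import Level using (Level; Lift; lift; lower; _⊔_) renaming (suc to lsuc)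
open import Relation.Binary.Definitions using (tri<; tri≈; tri>)
open import Relation.Binary.PropositionalEquality
  using (_≡_; _≢_; refl; sym; trans; cong; cong₂; subst; subst₂)
open import Relation.Binary.Structures using (IsEquivalence)
import Relation.Binary.Reasoning.Setoid as ≈-Reasoning
open import Relation.Nullary using (¬_; Dec; yes; no; does; Irrelevant)

infix 4 _≺_ ℵ₁≤_

_≺_ : ∀ {a b} → Set a → Set b → Set (a ⊔ b)
A ≺ B = (A ↣ B) × ¬ (B ↣ A)

-- ℵ₁ is the successor cardinal of ℵ₀, so ℵ₁ ≤ κ means ℵ₀ < κ.
ℵ₁≤_ : ∀ {a} → Set a → Set a
ℵ₁≤ κ = ℕ ≺ κ

≺-closed : ∀ {a b k} {A : Set a} {B : Set b} {κ : Set k} → A ↣ B → B ≺ κ → A ≺ κ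
≺-closed f (g , h) = (g ↣-∘ f) , λ k → h (f ↣-∘ k)

_×ᵢ_ : ∀ {a b c d} {A : Set a} {B : Set b} {C : Set c} {D : Set d} →
       A ↣ B → C ↣ D → (A × C) ↣ (B × D)
_×ᵢ_ {A = A} {B} {C} {D} f g = mk↣ {to = h} λ eq →
  cong₂ _,_ (injective f (cong proj₁ eq)) (injective g (cong proj₂ eq))
  where
  open Injection using (to; injective)

  h : A × C → B × D
  h (a , c) = to f a , to g c

-- Excluded middle for all types, not only for propositions, also provides choice: it decides any
-- inhabited type by exhibiting an element.  Zorn's lemma and A × A ↣ A for infinite A follow, and
-- with them the closure of the sets of cardinality less than κ under products and sums.
module Cardinals
  (em : ∀ {a} → ExcludedMiddle a)
  (ext : ∀ {a b} → Extensionality a b)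
  where

  open import Data.Nat.Base using (suc; _+_; _*_; _<_)
  open import Function.Base using (id)
  open Injection using (to; injective)

  Sub : ∀ {i} → Set i → Set i
  Sub X = X → Bool

  infix 4 _∈_ _⊆_

  _∈_ : ∀ {i} {X : Set i} → X → Sub X → Set
  x ∈ S = S x ≡ true

  _⊆_ : ∀ {i} {X : Set i} → Sub X → Sub X → Set i
  S ⊆ S′ = ∀ x → x ∈ S → x ∈ S′

  ⟦_⟧ : ∀ {i p} {X : Set i} → (X → Set p) → Sub X
  ⟦ P ⟧ x = does (em {P = P x})

  ∈⟦⟧⁺ : ∀ {i p} {X : Set i} (P : X → Set p) {x} → P x → x ∈ ⟦ P ⟧
  ∈⟦⟧⁺ P {x} p with em {P = P x}
  ... | yes _ = refl
  ... | no ¬p = ⊥-elim (¬p p)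

  ∈⟦⟧⁻ : ∀ {i p} {X : Set i} (P : X → Set p) {x} → x ∈ ⟦ P ⟧ → P x
  ∈⟦⟧⁻ P {x} x∈P with em {P = P x}
  ... | yes p = p

  ⊆-antisym : ∀ {i} {X : Set i} {S S′ : Sub X} → S ⊆ S′ → S′ ⊆ S → S ≡ S′
  ⊆-antisym {S = S} {S′} p q = ext λ x → lemma (S x) (S′ x) (p x) (q x)
    where
    lemma : ∀ b b′ → (b ≡ true → b′ ≡ true) → (b′ ≡ true → b ≡ true) → b ≡ b′
    lemma true  b′    p q = sym (p refl)
    lemma false true  p q = q refl
    lemma false false p q = refl

  ∈-irrelevant : ∀ {i} {X : Set i} (S : Sub X) {x} → Irrelevant (x ∈ S)
  ∈-irrelevant S = uip

  ⋃ : ∀ {i} {X : Set i} → Sub (Sub X) → Sub X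
  ⋃ C = ⟦ (λ x → Σ[ S ∈ _ ] (S ∈ C × x ∈ S)) ⟧

  ∈⋃⁻ : ∀ {i} {X : Set i} {C : Sub (Sub X)} {x} → x ∈ ⋃ C → Σ[ S ∈ _ ] (S ∈ C × x ∈ S)
  ∈⋃⁻ {C = C} = ∈⟦⟧⁻ (λ x → Σ[ S ∈ _ ] (S ∈ C × x ∈ S))

  ⊆-⋃ : ∀ {i} {X : Set i} {C : Sub (Sub X)} {S} → S ∈ C → S ⊆ ⋃ C
  ⊆-⋃ {C = C} S∈C x x∈S = ∈⟦⟧⁺ (λ x → Σ[ S ∈ _ ] (S ∈ C × x ∈ S)) (_ , S∈C , x∈S)

  IsChain : ∀ {i} {X : Set i} → Sub (Sub X) → Set i
  IsChain C = ∀ {S S′} → S ∈ C → S′ ∈ C → S ⊆ S′ ⊎ S′ ⊆ S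

  ∈⋃₂⁻ : ∀ {i} {X : Set i} {C : Sub (Sub X)} → IsChain C → ∀ {x y} → x ∈ ⋃ C → y ∈ ⋃ C →
         Σ[ S ∈ _ ] (S ∈ C × x ∈ S × y ∈ S)
  ∈⋃₂⁻ chain x∈ y∈ with ∈⋃⁻ x∈ | ∈⋃⁻ y∈
  ... | S , S∈C , x∈S | S′ , S′∈C , y∈S′ with chain S∈C S′∈C
  ... | inj₁ S⊆S′ = S′ , S′∈C , S⊆S′ _ x∈S , y∈S′
  ... | inj₂ S′⊆S = S , S∈C , x∈S , S′⊆S _ y∈S′

  Extends : ∀ {i} {X : Set i} → (Sub X → Set i) → Sub X → Set i
  Extends {X = X} 𝓕 S = Σ[ S′ ∈ Sub X ] (𝓕 S′ × S ⊆ S′ × ¬ (S′ ⊆ S))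

  module Zorn {i} {X : Set i} (𝓕 : Sub X → Set i) (S₀ : Sub X) (𝓕₀ : 𝓕 S₀)
    (⋃-closed : ∀ {S} C → S ∈ C → (∀ {S} → S ∈ C → 𝓕 S) → IsChain C → 𝓕 (⋃ C))
    where

    next : Sub X → Sub X
    next S with em {P = Extends 𝓕 S}
    ... | yes (S′ , _) = S′
    ... | no _ = S

    ⊆-next : ∀ S → S ⊆ next S
    ⊆-next S with em {P = Extends 𝓕 S}
    ... | yes (_ , _ , S⊆S′ , _) = S⊆S′
    ... | no _ = λ _ → id

    next-𝓕 : ∀ {S} → 𝓕 S → 𝓕 (next S)
    next-𝓕 {S} p with em {P = Extends 𝓕 S}
    ... | yes (_ , q , _) = q
    ... | no _ = p

    next-fixed : ∀ {S} → next S ⊆ S → ¬ Extends 𝓕 S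
    next-fixed {S} p with em {P = Extends 𝓕 S}
    ... | yes (_ , _ , _ , S′⊈S) = λ _ → S′⊈S p
    ... | no ¬e = ¬e

    data Stage : Sub X → Set i where
      base : Stage S₀
      step : ∀ {S} → Stage S → Stage (next S)
      sup  : ∀ {S} C → S ∈ C → (∀ {S} → S ∈ C → Stage S) → Stage (⋃ C)

    base⊆ : ∀ {S} → Stage S → S₀ ⊆ S
    base⊆ base x x∈ = x∈
    base⊆ (step t) x x∈ = ⊆-next _ x (base⊆ t x x∈)
    base⊆ (sup C S∈C h) x x∈ = ⊆-⋃ S∈C x (base⊆ (h S∈C) x x∈)

    sup-compare : ∀ {S′ S″} (C : Sub (Sub X)) → (∀ {S} → S ∈ C → S ⊆ S″ ⊎ S′ ⊆ S) →
                  ⋃ C ⊆ S″ ⊎ S′ ⊆ ⋃ C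
    sup-compare {S′} C h with em {P = Σ[ S ∈ Sub X ] (S ∈ C × S′ ⊆ S)}
    ... | yes (S , S∈C , S′⊆S) = inj₂ λ x x∈ → ⊆-⋃ S∈C x (S′⊆S x x∈)
    ... | no ¬∃ = inj₁ λ x x∈ → case x (∈⋃⁻ x∈)
      where
      case : ∀ x → _ → _
      case x (S , S∈C , x∈S) with h S∈C
      ... | inj₁ S⊆S″ = S⊆S″ x x∈S
      ... | inj₂ S′⊆S = ⊥-elim (¬∃ (S , S∈C , S′⊆S))

    compare  : ∀ {S S′} → Stage S → Stage S′ → S ⊆ S′ ⊎ next S′ ⊆ S
    compare′ : ∀ {S S′} → Stage S → Stage S′ → S′ ⊆ S ⊎ next S ⊆ S′

    compare base t′ = inj₁ (base⊆ t′)
    compare (step t) t′ with compare′ t t′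
    ... | inj₂ p = inj₁ p
    ... | inj₁ p with compare t t′
    ...   | inj₂ q = inj₂ λ x x∈ → ⊆-next _ x (q x x∈)
    ...   | inj₁ q with refl ← ⊆-antisym p q = inj₂ λ _ → id
    compare (sup C S∈C h) t′ = sup-compare C λ S∈C → compare (h S∈C) t′

    compare′ t base = inj₁ (base⊆ t)
    compare′ t (step t′) with compare′ t t′
    ... | inj₂ p = inj₂ λ x x∈ → ⊆-next _ x (p x x∈)
    ... | inj₁ p with compare t t′
    ...   | inj₂ q = inj₁ q
    ...   | inj₁ q with refl ← ⊆-antisym p q = inj₂ λ _ → id
    compare′ t (sup C S∈C h) = sup-compare C λ S∈C → compare′ t (h S∈C)

    stages-chain : ∀ {S S′} → Stage S → Stage S′ → S ⊆ S′ ⊎ S′ ⊆ S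
    stages-chain t t′ with compare t t′
    ... | inj₁ p = inj₁ p
    ... | inj₂ p = inj₂ λ x x∈ → p x (⊆-next _ x x∈)

    stage-𝓕 : ∀ {S} → Stage S → 𝓕 S
    stage-𝓕 base = 𝓕₀
    stage-𝓕 (step t) = next-𝓕 (stage-𝓕 t)
    stage-𝓕 (sup C S∈C h) =
      ⋃-closed C S∈C (λ p → stage-𝓕 (h p)) (λ p q → stages-chain (h p) (h q))

    zorn : Σ[ S ∈ Sub X ] (𝓕 S × ¬ Extends 𝓕 S)
    zorn = ⋃ ⟦ Stage ⟧ , stage-𝓕 top , next-fixed (⊆-⋃ (∈⟦⟧⁺ Stage (step top)))
      where
      top : Stage (⋃ ⟦ Stage ⟧)
      top = sup ⟦ Stage ⟧ (∈⟦⟧⁺ Stage base) (∈⟦⟧⁻ Stage)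

  module Comparability {i} (A B : Set i) where

    record 𝓕 (R : Sub (A × B)) : Set i where
      field
        functional : ∀ {a b b′} → (a , b) ∈ R → (a , b′) ∈ R → b ≡ b′
        injective′ : ∀ {a a′ b} → (a , b) ∈ R → (a′ , b) ∈ R → a ≡ a′

    open 𝓕

    𝓕₀ : 𝓕 (λ _ → false)
    𝓕₀ = record { functional = λ () ; injective′ = λ () }

    ⋃-closed : ∀ {S} C → S ∈ C → (∀ {S} → S ∈ C → 𝓕 S) → IsChain C → 𝓕 (⋃ C)
    ⋃-closed C _ h chain = record
      { functional = λ p q → let _ , S∈C , p′ , q′ = ∈⋃₂⁻ chain p q in functional (h S∈C) p′ q′
      ; injective′ = λ p q → let _ , S∈C , p′ , q′ = ∈⋃₂⁻ chain p q in injective′ (h S∈C) p′ q′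
      }

    comparability : (A ↣ B) ⊎ (B ↣ A)
    comparability with Zorn.zorn 𝓕 (λ _ → false) 𝓕₀ ⋃-closed
    ... | R , R∈𝓕 , maximal with em {P = ∀ a → Σ[ b ∈ B ] ((a , b) ∈ R)}
    ... | yes f = inj₁ (mk↣ {to = proj₁ ∘ f} λ {a} {a′} eq →
            injective′ R∈𝓕 (subst (λ b → (a , b) ∈ R) eq (proj₂ (f a))) (proj₂ (f a′)))
    ... | no ¬f with em {P = ∀ b → Σ[ a ∈ A ] ((a , b) ∈ R)}
    ...   | yes g = inj₂ (mk↣ {to = proj₁ ∘ g} λ {b} {b′} eq →
            functional R∈𝓕 (subst (λ a → (a , b) ∈ R) eq (proj₂ (g b))) (proj₂ (g b′)))
    ...   | no ¬g = ⊥-elim (¬f λ a → dne λ ¬a → ¬g λ b → dne λ ¬b →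
              maximal (extension a b (λ b′ r → ¬a (b′ , r)) (λ a′ r → ¬b (a′ , r))))
      where
      dne : ∀ {p} {P : Set p} → ¬ ¬ P → P
      dne {P = P} ¬¬p with em {P = P}
      ... | yes p = p
      ... | no ¬p = ⊥-elim (¬¬p ¬p)

      extension : ∀ a b → (∀ b′ → ¬ (a , b′) ∈ R) → (∀ a′ → ¬ (a′ , b) ∈ R) → Extends 𝓕 R
      extension a b ¬a ¬b =
        ⟦ P ⟧
        , record { functional = λ p q → fun (∈⟦⟧⁻ P p) (∈⟦⟧⁻ P q)
                 ; injective′ = λ p q → inj (∈⟦⟧⁻ P p) (∈⟦⟧⁻ P q) }
        , (λ _ → ∈⟦⟧⁺ P ∘ inj₁)
        , λ R′⊆R → ¬a b (R′⊆R (a , b) (∈⟦⟧⁺ P (inj₂ refl)))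
        where
        P : A × B → Set i
        P x = (x ∈ R) ⊎ x ≡ (a , b)

        fun : ∀ {a b b′} → P (a , b) → P (a , b′) → b ≡ b′
        fun (inj₁ p) (inj₁ q) = functional R∈𝓕 p q
        fun (inj₁ p) (inj₂ refl) = ⊥-elim (¬a _ p)
        fun (inj₂ refl) (inj₁ q) = ⊥-elim (¬a _ q)
        fun (inj₂ refl) (inj₂ refl) = refl

        inj : ∀ {a a′ b} → P (a , b) → P (a′ , b) → a ≡ a′
        inj (inj₁ p) (inj₁ q) = injective′ R∈𝓕 p q
        inj (inj₁ p) (inj₂ refl) = ⊥-elim (¬b _ p)
        inj (inj₂ refl) (inj₁ q) = ⊥-elim (¬b _ q)
        inj (inj₂ refl) (inj₂ refl) = refl

  open Comparability using (comparability)

  pair : ℕ × ℕ → ℕ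
  pair (m , n) = (m + n) * (m + n) + m

  pair-< : ∀ m n m′ n′ → m + n < m′ + n′ → pair (m , n) < pair (m′ , n′)
  pair-< m n m′ n′ p = begin-strict
    (m + n) * (m + n) + m           ≤⟨ ℕ.+-monoʳ-≤ ((m + n) * (m + n)) (ℕ.m≤m+n m n) ⟩
    (m + n) * (m + n) + (m + n)     ≡⟨ ℕ.+-comm ((m + n) * (m + n)) (m + n) ⟩
    suc (m + n) * (m + n)           <⟨ ℕ.*-monoʳ-< (suc (m + n)) (ℕ.n<1+n (m + n)) ⟩
    suc (m + n) * suc (m + n)       ≤⟨ ℕ.*-mono-≤ p p ⟩
    (m′ + n′) * (m′ + n′)           ≤⟨ ℕ.m≤m+n _ m′ ⟩
    (m′ + n′) * (m′ + n′) + m′      ∎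
    where
    open ℕ.≤-Reasoning

  pair-injective : ∀ {x y} → pair x ≡ pair y → x ≡ y
  pair-injective {m , n} {m′ , n′} eq with ℕ.<-cmp (m + n) (m′ + n′)
  ... | tri< lt _ _ = ⊥-elim (ℕ.<⇒≢ (pair-< m n m′ n′ lt) eq)
  ... | tri> _ _ gt = ⊥-elim (ℕ.<⇒≢ (pair-< m′ n′ m n gt) (sym eq))
  ... | tri≈ _ s _ = cong₂ _,_ m≡m′ (ℕ.+-cancelˡ-≡ m n n′ (trans s (cong (_+ n′) (sym m≡m′))))
    where
    m≡m′ : m ≡ m′
    m≡m′ = ℕ.+-cancelˡ-≡ ((m + n) * (m + n)) m m′
             (trans eq (cong (λ k → k * k + m′) (sym s)))

  module Hessenberg {i} (M : Set i) (ι : ℕ ↣ M) where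

    -- A subset of M together with the graph of a multiplication on it.
    X : Set i
    X = M ⊎ (M × M × M)

    record 𝓕 (R : Sub X) : Set i where
      field
        functional : ∀ {x y z z′} → inj₂ (x , y , z) ∈ R → inj₂ (x , y , z′) ∈ R → z ≡ z′
        injective′ : ∀ {x y x′ y′ z} → inj₂ (x , y , z) ∈ R → inj₂ (x′ , y′ , z) ∈ R →
                     x ≡ x′ × y ≡ y′
        total      : ∀ {x y} → inj₁ x ∈ R → inj₁ y ∈ R → Σ[ z ∈ M ] (inj₂ (x , y , z) ∈ R)
        domain     : ∀ {x y z} → inj₂ (x , y , z) ∈ R → inj₁ x ∈ R × inj₁ y ∈ R × inj₁ z ∈ R
        infinite   : ∀ n → inj₁ (to ι n) ∈ R

    open 𝓕

    P₀ : X → Set i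
    P₀ (inj₁ x) = Σ[ n ∈ ℕ ] (to ι n ≡ x)
    P₀ (inj₂ (x , y , z)) =
      Σ[ p ∈ ℕ × ℕ ] (to ι (proj₁ p) ≡ x × to ι (proj₂ p) ≡ y × to ι (pair p) ≡ z)

    𝓕₀ : 𝓕 ⟦ P₀ ⟧
    𝓕₀ .functional {x} {y} {z} {z′} p q =
      fun {x} {y} (∈⟦⟧⁻ P₀ {inj₂ (x , y , z)} p) (∈⟦⟧⁻ P₀ {inj₂ (x , y , z′)} q)
      where
      fun : ∀ {x y z z′} → P₀ (inj₂ (x , y , z)) → P₀ (inj₂ (x , y , z′)) → z ≡ z′
      fun (p , refl , refl , refl) (q , eq₁ , eq₂ , refl) =
        cong (to ι ∘ pair) (cong₂ _,_ (sym (injective ι eq₁)) (sym (injective ι eq₂)))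
    𝓕₀ .injective′ {x} {y} {x′} {y′} {z} p q =
      inj {z = z} (∈⟦⟧⁻ P₀ {inj₂ (x , y , z)} p) (∈⟦⟧⁻ P₀ {inj₂ (x′ , y′ , z)} q)
      where
      inj : ∀ {x y x′ y′ z} → P₀ (inj₂ (x , y , z)) → P₀ (inj₂ (x′ , y′ , z)) → x ≡ x′ × y ≡ y′
      inj (p , refl , refl , refl) (q , refl , refl , eq)
        with refl ← pair-injective {q} {p} (injective ι eq) = refl , refl
    𝓕₀ .total {x} {y} p q =
      let m , eq  = ∈⟦⟧⁻ P₀ {inj₁ x} p
          n , eq′ = ∈⟦⟧⁻ P₀ {inj₁ y} q
      in to ι (pair (m , n)) , ∈⟦⟧⁺ P₀ {inj₂ _} ((m , n) , eq , eq′ , refl)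
    𝓕₀ .domain {x} {y} {z} p =
      let (m , n) , eq , eq′ , eq″ = ∈⟦⟧⁻ P₀ {inj₂ (x , y , z)} p
      in ∈⟦⟧⁺ P₀ {inj₁ x} (m , eq) , ∈⟦⟧⁺ P₀ {inj₁ y} (n , eq′) ,
         ∈⟦⟧⁺ P₀ {inj₁ z} (pair (m , n) , eq″)
    𝓕₀ .infinite n = ∈⟦⟧⁺ P₀ {inj₁ _} (n , refl)

    ⋃-closed : ∀ {S} C → S ∈ C → (∀ {S} → S ∈ C → 𝓕 S) → IsChain C → 𝓕 (⋃ C)
    ⋃-closed C S∈C h chain = record
      { functional = λ p q → let _ , S∈C , p′ , q′ = ∈⋃₂⁻ chain p q in functional (h S∈C) p′ q′
      ; injective′ = λ p q → let _ , S∈C , p′ , q′ = ∈⋃₂⁻ chain p q in injective′ (h S∈C) p′ q′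
      ; total = λ p q → let _ , S∈C , p′ , q′ = ∈⋃₂⁻ chain p q
                            z , r = total (h S∈C) p′ q′
                        in z , ⊆-⋃ S∈C _ r
      ; domain = λ p → let _ , S∈C , p′ = ∈⋃⁻ p
                           x , y , z = domain (h S∈C) p′
                       in ⊆-⋃ S∈C _ x , ⊆-⋃ S∈C _ y , ⊆-⋃ S∈C _ z
      ; infinite = λ n → ⊆-⋃ S∈C _ (infinite (h S∈C) n)
      }

    module Maximal (R : Sub X) (R∈𝓕 : 𝓕 R) where

      T T′ : Set i
      T  = Σ[ m ∈ M ] (inj₁ m ∈ R)
      T′ = Σ[ m ∈ M ] (¬ inj₁ m ∈ R)

      T-≡ : ∀ {t u : T} → proj₁ t ≡ proj₁ u → t ≡ u
      T-≡ {_ , p} {_ , q} refl = cong (_ ,_) (∈-irrelevant R {inj₁ _} p q)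

      mul : T × T → T
      mul ((x , p) , (y , q)) =
        let z , r = total R∈𝓕 p q in z , proj₂ (proj₂ (domain R∈𝓕 r))

      mul-R : ∀ t u → inj₂ (proj₁ t , proj₁ u , proj₁ (mul (t , u))) ∈ R
      mul-R (x , p) (y , q) = proj₂ (total R∈𝓕 p q)

      square : (T × T) ↣ T
      square = mk↣ {to = mul} λ {(t , u)} {(t′ , u′)} eq →
        let r  = subst (λ z → inj₂ (proj₁ t , proj₁ u , proj₁ z) ∈ R) eq (mul-R t u)
            eq₁ , eq₂ = injective′ R∈𝓕 r (mul-R t′ u′)
        in cong₂ _,_ (T-≡ eq₁) (T-≡ eq₂)

      ν : ℕ → T
      ν n = to ι n , infinite R∈𝓕 n

      ν₀≢ν₁ : ν 0 ≢ ν 1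
      ν₀≢ν₁ eq with () ← injective ι (cong proj₁ eq)

      double : (T ⊎ T) ↣ T
      double = square ↣-∘ mk↣ {to = f} f-injective
        where
        f : T ⊎ T → T × T
        f (inj₁ t) = ν 0 , t
        f (inj₂ t) = ν 1 , t

        f-injective : ∀ {t u} → f t ≡ f u → t ≡ u
        f-injective {inj₁ t} {inj₁ u} eq = cong inj₁ (cong proj₂ eq)
        f-injective {inj₁ t} {inj₂ u} eq = ⊥-elim (ν₀≢ν₁ (cong proj₁ eq))
        f-injective {inj₂ t} {inj₁ u} eq = ⊥-elim (ν₀≢ν₁ (sym (cong proj₁ eq)))
        f-injective {inj₂ t} {inj₂ u} eq = cong inj₂ (cong proj₂ eq)

      large : T′ ↣ T → (M × M) ↣ M
      large g = mk↣ {to = proj₁} T-≡ ↣-∘ (square ↣-∘ (M↣T ×ᵢ M↣T))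
        where
        split : (m : M) → Dec (inj₁ m ∈ R) → T ⊎ T
        split m (yes p) = inj₁ (m , p)
        split m (no ¬p) = inj₂ (to g (m , ¬p))

        split-injective : ∀ {m n} d d′ → split m d ≡ split n d′ → m ≡ n
        split-injective (yes _) (yes _) eq = cong proj₁ (inj₁-injective eq)
        split-injective (no _) (no _) eq = cong proj₁ (injective g (inj₂-injective eq))

        M↣T : M ↣ T
        M↣T = double ↣-∘ mk↣ {to = λ m → split m em} (split-injective em em)

      small : T ↣ T′ → Extends 𝓕 R
      small g = ⟦ P ⟧ , P∈𝓕 , R⊆ , ⊈R
        where
        val : T ⊎ T → M
        val (inj₁ t) = proj₁ t
        val (inj₂ t) = proj₁ (to g t)

        T′-≡ : ∀ {t u : T′} → proj₁ t ≡ proj₁ u → t ≡ u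
        T′-≡ {_ , p} {_ , q} refl = cong (_ ,_) (ext λ x → ⊥-elim (p x))

        val-injective : ∀ {u v} → val u ≡ val v → u ≡ v
        val-injective {inj₁ _} {inj₁ _} eq = cong inj₁ (T-≡ eq)
        val-injective {inj₁ t} {inj₂ u} eq =
          ⊥-elim (proj₂ (to g u) (subst (λ m → inj₁ m ∈ R) eq (proj₂ t)))
        val-injective {inj₂ u} {inj₁ t} eq =
          ⊥-elim (proj₂ (to g u) (subst (λ m → inj₁ m ∈ R) (sym eq) (proj₂ t)))
        val-injective {inj₂ _} {inj₂ _} eq = cong inj₂ (injective g (T′-≡ eq))

        code : ((T ⊎ T) × (T ⊎ T)) ↣ T
        code = square ↣-∘ (double ×ᵢ double)

        new : (T ⊎ T) × (T ⊎ T) → M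
        new p = val (inj₂ (to code p))

        new-injective : ∀ {p q} → new p ≡ new q → p ≡ q
        new-injective {p} {q} eq =
          injective code (inj₂-injective (val-injective {inj₂ (to code p)} {inj₂ (to code q)} eq))

        new∉R : ∀ p → ¬ inj₁ (new p) ∈ R
        new∉R p = proj₂ (to g (to code p))

        P : X → Set i
        P (inj₁ m) = Σ[ u ∈ T ⊎ T ] (val u ≡ m)
        P (inj₂ (x , y , z)) = inj₂ (x , y , z) ∈ R ⊎
          (¬ (inj₁ x ∈ R × inj₁ y ∈ R) ×
           Σ[ p ∈ (T ⊎ T) × (T ⊎ T) ] (val (proj₁ p) ≡ x × val (proj₂ p) ≡ y × new p ≡ z))

        old : ∀ {m} → inj₁ m ∈ R → P (inj₁ m)
        old {m} p = inj₁ (m , p) , refl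

        R⊆ : R ⊆ ⟦ P ⟧
        R⊆ (inj₁ m) p = ∈⟦⟧⁺ P (old p)
        R⊆ (inj₂ r) p = ∈⟦⟧⁺ P {inj₂ r} (inj₁ p)

        ⊈R : ¬ (⟦ P ⟧ ⊆ R)
        ⊈R sub = proj₂ (to g (ν 0)) (sub _ (∈⟦⟧⁺ P {inj₁ _} (inj₂ (ν 0) , refl)))

        fun : ∀ {x y z z′} → P (inj₂ (x , y , z)) → P (inj₂ (x , y , z′)) → z ≡ z′
        fun (inj₁ p) (inj₁ q) = functional R∈𝓕 p q
        fun (inj₁ p) (inj₂ (¬d , _)) =
          let dx , dy , _ = domain R∈𝓕 p in ⊥-elim (¬d (dx , dy))
        fun (inj₂ (¬d , _)) (inj₁ p) =
          let dx , dy , _ = domain R∈𝓕 p in ⊥-elim (¬d (dx , dy))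
        fun (inj₂ (_ , (u , v) , refl , refl , refl)) (inj₂ (_ , (u′ , v′) , eq₁ , eq₂ , refl)) =
          cong new (cong₂ _,_ (sym (val-injective {u′} {u} eq₁)) (sym (val-injective {v′} {v} eq₂)))

        inj : ∀ {x y x′ y′ z} → P (inj₂ (x , y , z)) → P (inj₂ (x′ , y′ , z)) → x ≡ x′ × y ≡ y′
        inj (inj₁ p) (inj₁ q) = injective′ R∈𝓕 p q
        inj (inj₁ p) (inj₂ (_ , q , _ , _ , refl)) =
          ⊥-elim (new∉R q (proj₂ (proj₂ (domain R∈𝓕 p))))
        inj (inj₂ (_ , q , _ , _ , refl)) (inj₁ p) =
          ⊥-elim (new∉R q (proj₂ (proj₂ (domain R∈𝓕 p))))
        inj (inj₂ (_ , p , refl , refl , refl)) (inj₂ (_ , q , refl , refl , eq))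
          with refl ← new-injective {q} {p} eq = refl , refl

        tot : ∀ {x y} → P (inj₁ x) → P (inj₁ y) → Σ[ z ∈ M ] P (inj₂ (x , y , z))
        tot {x} {y} (u , eq₁) (v , eq₂) with em {P = inj₁ x ∈ R × inj₁ y ∈ R}
        ... | yes (p , q) = let z , r = total R∈𝓕 p q in z , inj₁ r
        ... | no ¬d = new (u , v) , inj₂ (¬d , (u , v) , eq₁ , eq₂ , refl)

        dom : ∀ {x y z} → P (inj₂ (x , y , z)) → P (inj₁ x) × P (inj₁ y) × P (inj₁ z)
        dom (inj₁ p) = let x , y , z = domain R∈𝓕 p in old x , old y , old z
        dom (inj₂ (_ , p , eq₁ , eq₂ , eq₃)) =
          (proj₁ p , eq₁) , (proj₂ p , eq₂) , (inj₂ (to code p) , eq₃)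

        P∈𝓕 : 𝓕 ⟦ P ⟧
        P∈𝓕 = record
          { functional = λ p q → fun (∈⟦⟧⁻ P p) (∈⟦⟧⁻ P q)
          ; injective′ = λ p q → inj (∈⟦⟧⁻ P p) (∈⟦⟧⁻ P q)
          ; total = λ p q → let z , r = tot (∈⟦⟧⁻ P p) (∈⟦⟧⁻ P q) in z , ∈⟦⟧⁺ P r
          ; domain = λ p → let x , y , z = dom (∈⟦⟧⁻ P p)
                           in ∈⟦⟧⁺ P x , ∈⟦⟧⁺ P y , ∈⟦⟧⁺ P z
          ; infinite = λ n → R⊆ _ (infinite R∈𝓕 n)
          }

    hessenberg : (M × M) ↣ M
    hessenberg =
      let R , R∈𝓕 , maximal = Zorn.zorn 𝓕 ⟦ P₀ ⟧ 𝓕₀ ⋃-closed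
      in [ (λ g → ⊥-elim (maximal (Maximal.small R R∈𝓕 g))) , Maximal.large R R∈𝓕 ]′
           (comparability (Maximal.T R R∈𝓕) (Maximal.T′ R R∈𝓕))

  open Hessenberg using (hessenberg)

  bound : ∀ {i} {A B κ : Set i} → ℵ₁≤ κ → A ≺ κ → B ≺ κ →
          Σ[ D ∈ Set i ] (D ≺ κ × ℕ ↣ D × A ↣ D × B ↣ D)
  bound {i} {A} {B} {κ} ℵ₁≤κ A≺κ B≺κ =
    let D , D≺κ , f , g = max A≺κ B≺κ
        E , E≺κ , h , k = max {Lift i ℕ} {D} (≺-closed (mk↣ {to = lower} (cong lift)) ℵ₁≤κ) D≺κ
    in E , E≺κ , h ↣-∘ mk↣ {to = lift} (cong lower) , k ↣-∘ f , k ↣-∘ g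
    where
    max : ∀ {A B : Set i} → A ≺ κ → B ≺ κ → Σ[ D ∈ Set i ] (D ≺ κ × A ↣ D × B ↣ D)
    max {A} {B} p q with comparability A B
    ... | inj₁ f = B , q , f , ↣-id B
    ... | inj₂ g = A , p , ↣-id A , g

  ≺-× : ∀ {i} {A B κ : Set i} → ℵ₁≤ κ → A ≺ κ → B ≺ κ → (A × B) ≺ κ
  ≺-× ℵ₁≤κ A≺κ B≺κ =
    let D , D≺κ , ι , f , g = bound ℵ₁≤κ A≺κ B≺κ
    in ≺-closed (hessenberg D ι ↣-∘ (f ×ᵢ g)) D≺κ

  ≺-⊎ : ∀ {i} {A B κ : Set i} → ℵ₁≤ κ → A ≺ κ → B ≺ κ → (A ⊎ B) ≺ κ
  ≺-⊎ {A = A} {B} ℵ₁≤κ A≺κ B≺κ =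
    let D , D≺κ , ι , f , g = bound ℵ₁≤κ A≺κ B≺κ
    in ≺-closed (hessenberg D ι ↣-∘ tagged ι f g) D≺κ
    where
    tagged : ∀ {D} → ℕ ↣ D → A ↣ D → B ↣ D → (A ⊎ B) ↣ (D × D)
    tagged ι f g = mk↣ {to = h} h-injective
      where
      h : A ⊎ B → _ × _
      h (inj₁ a) = to ι 0 , to f a
      h (inj₂ b) = to ι 1 , to g b

      h-injective : ∀ {x y} → h x ≡ h y → x ≡ y
      h-injective {inj₁ _} {inj₁ _} eq = cong inj₁ (injective f (cong proj₂ eq))
      h-injective {inj₁ _} {inj₂ _} eq with () ← injective ι (cong proj₁ eq)
      h-injective {inj₂ _} {inj₁ _} eq with () ← injective ι (cong proj₁ eq)
      h-injective {inj₂ _} {inj₂ _} eq = cong inj₂ (injective g (cong proj₂ eq))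

record Category (o h e : Level) : Set (lsuc (o ⊔ h ⊔ e)) where
  infix  4 _≈_
  infixr 9 _⨾_
  field
    Obj       : Set o
    Hom       : Obj → Obj → Set h
    _≈_       : ∀ {A B} → Hom A B → Hom A B → Set e
    id        : ∀ {A} → Hom A A
    -- Diagrammatic order: f ⨾ g is f followed by g.
    _⨾_       : ∀ {A B C} → Hom A B → Hom B C → Hom A C
    isEquiv   : ∀ {A B} → IsEquivalence (_≈_ {A} {B})
    ⨾-cong    : ∀ {A B C} {f f′ : Hom A B} {g g′ : Hom B C} → f ≈ f′ → g ≈ g′ → f ⨾ g ≈ f′ ⨾ g′
    assoc     : ∀ {A B C D} (f : Hom A B) (g : Hom B C) (h : Hom C D) →
                (f ⨾ g) ⨾ h ≈ f ⨾ (g ⨾ h)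
    identityˡ : ∀ {A B} (f : Hom A B) → id ⨾ f ≈ f
    identityʳ : ∀ {A B} (f : Hom A B) → f ⨾ id ≈ f

-- The data of a monoidal structure.  The interchange law is not demanded: it fails for ⊗ on both
-- categories below when Ω is not commutative, and strictness of a functor only concerns the data.
record MonoidalData {o h e} (𝐂 : Category o h e) : Set (o ⊔ h ⊔ e) where
  open Category 𝐂
  infixr 10 _⊗₀_ _⊗₁_
  field
    _⊗₀_       : Obj → Obj → Obj
    _⊗₁_       : ∀ {A B A′ B′} → Hom A B → Hom A′ B′ → Hom (A ⊗₀ A′) (B ⊗₀ B′)
    ⊗₁-cong    : ∀ {A B A′ B′} {f g : Hom A B} {f′ g′ : Hom A′ B′} →
                 f ≈ g → f′ ≈ g′ → f ⊗₁ f′ ≈ g ⊗₁ g′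
    unit       : Obj
    associator : ∀ A B C → Hom ((A ⊗₀ B) ⊗₀ C) (A ⊗₀ (B ⊗₀ C))
    unitorˡ    : ∀ A → Hom (unit ⊗₀ A) A
    unitorʳ    : ∀ A → Hom (A ⊗₀ unit) A

record IsFunctor
  {o h e o′ h′ e′} (𝐂 : Category o h e) (𝐃 : Category o′ h′ e′)
  (F₀ : Category.Obj 𝐂 → Category.Obj 𝐃)
  (F₁ : ∀ {A B} → Category.Hom 𝐂 A B → Category.Hom 𝐃 (F₀ A) (F₀ B))
  : Set (o ⊔ h ⊔ e ⊔ e′) where
  private
    module C = Category 𝐂
    module D = Category 𝐃
  field
    F₁-cong : ∀ {A B} {f g : C.Hom A B} → f C.≈ g → F₁ f D.≈ F₁ g
    F₁-id   : ∀ {A} → F₁ (C.id {A}) D.≈ D.id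
    F₁-⨾    : ∀ {A B C} (f : C.Hom A B) (g : C.Hom B C) → F₁ (f C.⨾ g) D.≈ F₁ f D.⨾ F₁ g

record IsStrictMonoidalFunctor
  {o h e o′ h′ e′} {𝐂 : Category o h e} {𝐃 : Category o′ h′ e′}
  (𝐌 : MonoidalData 𝐂) (𝐍 : MonoidalData 𝐃)
  (F₀ : Category.Obj 𝐂 → Category.Obj 𝐃)
  (F₁ : ∀ {A B} → Category.Hom 𝐂 A B → Category.Hom 𝐃 (F₀ A) (F₀ B))
  : Set (o ⊔ h ⊔ e ⊔ o′ ⊔ e′) where
  private
    module C = Category 𝐂
    module D = Category 𝐃
    module M = MonoidalData 𝐌
    module N = MonoidalData 𝐍

  cast : ∀ {A A′ B B′} → A ≡ A′ → B ≡ B′ → D.Hom A B → D.Hom A′ B′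
  cast = subst₂ D.Hom

  field
    isFunctor : IsFunctor 𝐂 𝐃 F₀ F₁
    F-⊗₀   : ∀ A B → F₀ (A M.⊗₀ B) ≡ F₀ A N.⊗₀ F₀ B
    F-unit : F₀ M.unit ≡ N.unit
    F-⊗₁   : ∀ {A B A′ B′} (f : C.Hom A B) (f′ : C.Hom A′ B′) →
             cast (F-⊗₀ A A′) (F-⊗₀ B B′) (F₁ (f M.⊗₁ f′)) D.≈ F₁ f N.⊗₁ F₁ f′
    F-associator :
      ∀ A B C →
      cast (trans (F-⊗₀ (A M.⊗₀ B) C) (cong (N._⊗₀ F₀ C) (F-⊗₀ A B)))
           (trans (F-⊗₀ A (B M.⊗₀ C)) (cong (F₀ A N.⊗₀_) (F-⊗₀ B C)))
           (F₁ (M.associator A B C))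
        D.≈ N.associator (F₀ A) (F₀ B) (F₀ C)
    F-unitorˡ :
      ∀ A → cast (trans (F-⊗₀ M.unit A) (cong (N._⊗₀ F₀ A) F-unit)) refl (F₁ (M.unitorˡ A))
              D.≈ N.unitorˡ (F₀ A)
    F-unitorʳ :
      ∀ A → cast (trans (F-⊗₀ A M.unit) (cong (F₀ A N.⊗₀_) F-unit)) refl (F₁ (M.unitorʳ A))
              D.≈ N.unitorʳ (F₀ A)

-- A semiring with a sum for every family indexed by a set of the universe Set i, subject to the
-- usual axioms of complete semirings.  A partition of I indexed by J is given by a map p : I → J.
record CompleteSemiring (c ℓ i : Level) : Set (lsuc (c ⊔ ℓ ⊔ i)) where
  field
    semiring : Semiring c ℓ
  open Semiring semiring public
  field
    ∑           : {I : Set i} → (I → Carrier) → Carrier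
    ∑-cong      : ∀ {I : Set i} {f g : I → Carrier} → (∀ x → f x ≈ g x) → ∑ f ≈ ∑ g
    ∑-empty     : ∀ {I : Set i} (f : I → Carrier) → ¬ I → ∑ f ≈ 0#
    ∑-singleton : ∀ {I : Set i} (f : I → Carrier) x → (∀ z → z ≡ x) → ∑ f ≈ f x
    ∑-pair      : ∀ {I : Set i} (f : I → Carrier) x y → x ≢ y → (∀ z → z ≡ x ⊎ z ≡ y) →
                  ∑ f ≈ f x + f y
    ∑-partition : ∀ {I J : Set i} (f : I → Carrier) (p : I → J) →
                  ∑ f ≈ ∑ λ y → ∑ {Σ[ x ∈ I ] p x ≡ y} λ (x , _) → f x
    ∑-distribˡ  : ∀ {I : Set i} a (f : I → Carrier) → a * ∑ f ≈ ∑ λ x → a * f x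
    ∑-distribʳ  : ∀ {I : Set i} a (f : I → Carrier) → ∑ f * a ≈ ∑ λ x → f x * a

Σ-≡ : ∀ {a b} {A : Set a} {B : Set b} {f g : A → B} {x y : Σ[ x ∈ A ] f x ≡ g x} →
      proj₁ x ≡ proj₁ y → x ≡ y
Σ-≡ {x = _ , p} {_ , q} refl = cong (_ ,_) (uip p q)

module SumProperties {c ℓ i} (Ω : CompleteSemiring c ℓ i) where
  open CompleteSemiring Ω hiding (refl; sym; trans; zero)
  private module Ω = CompleteSemiring Ω
  open ≈-Reasoning setoid

  ∑-↔ : ∀ {I J : Set i} (φ : I ↔ J) (f : J → Carrier) → ∑ (λ x → f (Inverse.to φ x)) ≈ ∑ f
  ∑-↔ {I} φ f = begin
    ∑ (λ x → f (Inverse.to φ x))                             ≈⟨ ∑-partition _ (Inverse.to φ) ⟩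
    ∑ (λ y → ∑ {Σ[ x ∈ I ] Inverse.to φ x ≡ y} λ (x , _) → f (Inverse.to φ x))
      ≈⟨ ∑-cong (λ y → Ω.trans (∑-cong λ (x , eq) → Ω.reflexive (cong f eq))
           (∑-singleton _ (Inverse.from φ y , Inverse.strictlyInverseˡ φ y) unique)) ⟩
    ∑ f                                                      ∎
    where
    unique : ∀ {y} (z : Σ[ x ∈ I ] Inverse.to φ x ≡ y) →
             z ≡ (Inverse.from φ y , Inverse.strictlyInverseˡ φ y)
    unique (x , refl) = Σ-≡ (sym (Inverse.strictlyInverseʳ φ x))

  ∑-Σ : ∀ {J : Set i} {I : J → Set i} (f : Σ J I → Carrier) → ∑ f ≈ ∑ λ y → ∑ λ x → f (y , x)
  ∑-Σ {J} {I} f = Ω.trans (∑-partition f proj₁) (∑-cong λ y → Ω.sym (∑-↔ (fibre y) _))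
    where
    fibre : ∀ y → I y ↔ (Σ[ p ∈ Σ J I ] proj₁ p ≡ y)
    fibre y = mk↔ₛ′ (λ x → (y , x) , refl) (λ { ((_ , x) , refl) → x })
                    (λ { (_ , refl) → refl }) (λ _ → refl)

  ∑-× : ∀ {I J : Set i} (f : I × J → Carrier) → ∑ f ≈ ∑ λ x → ∑ λ y → f (x , y)
  ∑-× = ∑-Σ

  ∑-swap : ∀ {I J : Set i} (f : I → J → Carrier) →
           (∑ λ x → ∑ λ y → f x y) ≈ (∑ λ y → ∑ λ x → f x y)
  ∑-swap {I} {J} f = begin
    ∑ (λ x → ∑ λ y → f x y)       ≈⟨ ∑-× _ ⟨
    ∑ (λ (x , y) → f x y)         ≈⟨ ∑-↔ exchange _ ⟨
    ∑ (λ (y , x) → f x y)         ≈⟨ ∑-× _ ⟩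
    ∑ (λ y → ∑ λ x → f x y)       ∎
    where
    exchange : (J × I) ↔ (I × J)
    exchange = mk↔ₛ′ Prod.swap Prod.swap (λ _ → refl) (λ _ → refl)

  ∑-supported : ∀ {I : Set i} (f : I → Carrier) x → (∀ z → Dec (z ≡ x)) →
                (∀ z → z ≢ x → f z ≈ 0#) → ∑ f ≈ f x
  ∑-supported {I} f x dec zero = begin
    ∑ f                                  ≈⟨ ∑-cong (λ z → pointwise z (dec z)) ⟩
    ∑ (λ z → ∑ {z ≡ x} λ _ → f x)        ≈⟨ ∑-Σ {I} {λ z → z ≡ x} (λ _ → f x) ⟨
    ∑ {Σ[ z ∈ I ] z ≡ x} (λ _ → f x)     ≈⟨ ∑-singleton _ (x , refl) (λ { (_ , refl) → refl }) ⟩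
    f x                                  ∎
    where
    pointwise : ∀ z → Dec (z ≡ x) → f z ≈ ∑ {z ≡ x} λ _ → f x
    pointwise z (yes refl) = Ω.sym (∑-singleton _ refl λ { refl → refl })
    pointwise z (no z≢x) = Ω.trans (zero z z≢x) (Ω.sym (∑-empty _ z≢x))

-- The set κ stands for its cardinality.
module Contraction
  (em : ∀ {a} → ExcludedMiddle a)
  (ext : ∀ {a b} → Extensionality a b)
  {i c ℓ} (κ : Set i) (ℵ₁≤κ : ℵ₁≤ κ)
  (Ω : CompleteSemiring c ℓ i)
  where

  open CompleteSemiring Ω hiding (refl; sym; trans; zero)
  private module Ω = CompleteSemiring Ω
  open SumProperties Ω

  -- The bound is irrelevant, so that an object is determined by its underlying set.
  record Set<κ : Set (lsuc i) where
    constructor ⟨_,_⟩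
    field
      ∣_∣    : Set i
      .small : ∣_∣ ≺ κ

  open Set<κ using (∣_∣)

  infixr 10 _×ₛ_ _⊎ₛ_

  _×ₛ_ : Set<κ → Set<κ → Set<κ
  ⟨ A , a ⟩ ×ₛ ⟨ B , b ⟩ = ⟨ A × B , Cardinals.≺-× em ext ℵ₁≤κ a b ⟩

  _⊎ₛ_ : Set<κ → Set<κ → Set<κ
  ⟨ A , a ⟩ ⊎ₛ ⟨ B , b ⟩ = ⟨ A ⊎ B , Cardinals.≺-⊎ em ext ℵ₁≤κ a b ⟩

  ⊤ₛ : Set<κ
  ⊤ₛ = ⟨ ⊤ , ≺-closed (mk↣ {to = λ _ → 0} λ _ → refl) ℵ₁≤κ ⟩

  ⊥ₛ : Set<κ
  ⊥ₛ = ⟨ ⊥ , ≺-closed (mk↣ {to = λ _ → 0} λ { {()} }) ℵ₁≤κ ⟩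

  subsetₛ : (A : Set<κ) (P : ∣ A ∣ → Set i) → (∀ x → Irrelevant (P x)) → Set<κ
  subsetₛ ⟨ A , a ⟩ P P-irr = ⟨ Σ A P , ≺-closed (mk↣ {to = proj₁} proj₁-injective) a ⟩
    where
    proj₁-injective : ∀ {x y : Σ A P} → proj₁ x ≡ proj₁ y → x ≡ y
    proj₁-injective {_ , p} {_ , q} refl = cong (_ ,_) (P-irr _ p q)

  record Triskell (S T : Set<κ) : Set (lsuc i ⊔ c) where
    field
      E : Set<κ
      s : ∣ E ∣ → ∣ S ∣
      t : ∣ E ∣ → ∣ T ∣
      w : ∣ E ∣ → Carrier

  open Triskell

  -- Serves as the equality of morphisms, which are triskells up to isomorphism.
  infix 4 _≅_

  record _≅_ {S T : Set<κ} (X Y : Triskell S T) : Set (i ⊔ ℓ) where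
    field
      edges : ∣ E X ∣ ↔ ∣ E Y ∣
    open Inverse edges public
    field
      s-≡ : ∀ e → s X e ≡ s Y (to e)
      t-≡ : ∀ e → t X e ≡ t Y (to e)
      w-≈ : ∀ e → w X e ≈ w Y (to e)

  open _≅_

  ≅-isEquivalence : ∀ {S T} → IsEquivalence (_≅_ {S} {T})
  ≅-isEquivalence = record
    { refl = record
      { edges = ↔-id _ ; s-≡ = λ _ → refl ; t-≡ = λ _ → refl ; w-≈ = λ _ → Ω.refl }
    ; sym = λ {X} {Y} φ → record
      { edges = ↔-sym (edges φ)
      ; s-≡ = λ e → sym (trans (s-≡ φ (from φ e)) (cong (s Y) (strictlyInverseˡ φ e)))
      ; t-≡ = λ e → sym (trans (t-≡ φ (from φ e)) (cong (t Y) (strictlyInverseˡ φ e)))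
      ; w-≈ = λ e → Ω.sym (Ω.trans (w-≈ φ (from φ e))
                                   (Ω.reflexive (cong (w Y) (strictlyInverseˡ φ e))))
      }
    ; trans = λ φ ψ → record
      { edges = edges ψ ↔-∘ edges φ
      ; s-≡ = λ e → trans (s-≡ φ e) (s-≡ ψ (to φ e))
      ; t-≡ = λ e → trans (t-≡ φ e) (t-≡ ψ (to φ e))
      ; w-≈ = λ e → Ω.trans (w-≈ φ e) (w-≈ ψ (to φ e))
      }
    }

  graph : ∀ {S T} → (∣ S ∣ → ∣ T ∣) → Triskell S T
  graph {S} f = record { E = S ; s = λ e → e ; t = f ; w = λ _ → 1# }

  compose : ∀ {S T U} → Triskell S T → Triskell T U → Triskell S U
  compose X Y = record
    { E = subsetₛ (E X ×ₛ E Y) (λ (e , e′) → t X e ≡ s Y e′) (λ _ → uip)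
    ; s = λ ((e , _) , _) → s X e
    ; t = λ ((_ , e′) , _) → t Y e′
    ; w = λ ((e , e′) , _) → w X e * w Y e′
    }

  Trisk : Category (lsuc i) (lsuc i ⊔ c) (i ⊔ ℓ)
  Trisk = record
    { Obj = Set<κ
    ; Hom = Triskell
    ; _≈_ = _≅_
    ; id = graph λ x → x
    ; _⨾_ = compose
    ; isEquiv = ≅-isEquivalence
    ; ⨾-cong = λ {_} {_} {_} {X} {X′} {Y} {Y′} φ ψ → record
      { edges = mk↔ₛ′
          (λ ((e , e′) , eq) → (to φ e , to ψ e′) , trans (sym (t-≡ φ e)) (trans eq (s-≡ ψ e′)))
          (λ ((e , e′) , eq) → (from φ e , from ψ e′) ,
            trans (t-≡ φ (from φ e)) (trans (cong (t X′) (strictlyInverseˡ φ e))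
              (trans eq (sym (trans (s-≡ ψ (from ψ e′)) (cong (s Y′) (strictlyInverseˡ ψ e′)))))))
          (λ ((e , e′) , _) → Σ-≡ (cong₂ _,_ (strictlyInverseˡ φ e) (strictlyInverseˡ ψ e′)))
          (λ ((e , e′) , _) → Σ-≡ (cong₂ _,_ (strictlyInverseʳ φ e) (strictlyInverseʳ ψ e′)))
      ; s-≡ = λ ((e , _) , _) → s-≡ φ e
      ; t-≡ = λ ((_ , e′) , _) → t-≡ ψ e′
      ; w-≈ = λ ((e , e′) , _) → *-cong (w-≈ φ e) (w-≈ ψ e′)
      }
    ; assoc = λ X Y Z → record
      { edges = mk↔ₛ′
          (λ ((((e , e′) , p) , e″) , q) → (e , ((e′ , e″) , q)) , p)
          (λ ((e , ((e′ , e″) , q)) , p) → (((e , e′) , p) , e″) , q)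
          (λ _ → refl) (λ _ → refl)
      ; s-≡ = λ _ → refl
      ; t-≡ = λ _ → refl
      ; w-≈ = λ _ → *-assoc _ _ _
      }
    ; identityˡ = λ X → record
      { edges = mk↔ₛ′ (λ ((_ , e) , _) → e) (λ e → (s X e , e) , refl)
                      (λ _ → refl) (λ { (_ , refl) → refl })
      ; s-≡ = λ { (_ , eq) → eq }
      ; t-≡ = λ _ → refl
      ; w-≈ = λ _ → *-identityˡ _
      }
    ; identityʳ = λ X → record
      { edges = mk↔ₛ′ (λ ((e , _) , _) → e) (λ e → (e , t X e) , refl)
                      (λ _ → refl) (λ { (_ , refl) → refl })
      ; s-≡ = λ _ → refl
      ; t-≡ = λ { (_ , eq) → sym eq }
      ; w-≈ = λ _ → *-identityʳ _
      }
    }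

  Trisk-⊗ : MonoidalData Trisk
  Trisk-⊗ = record
    { _⊗₀_ = _×ₛ_
    ; _⊗₁_ = λ X Y → record
      { E = E X ×ₛ E Y
      ; s = Prod.map (s X) (s Y)
      ; t = Prod.map (t X) (t Y)
      ; w = λ (e , e′) → w X e * w Y e′
      }
    ; ⊗₁-cong = λ φ ψ → record
      { edges = edges φ ×-↔ edges ψ
      ; s-≡ = λ (e , e′) → cong₂ _,_ (s-≡ φ e) (s-≡ ψ e′)
      ; t-≡ = λ (e , e′) → cong₂ _,_ (t-≡ φ e) (t-≡ ψ e′)
      ; w-≈ = λ (e , e′) → *-cong (w-≈ φ e) (w-≈ ψ e′)
      }
    ; unit = ⊤ₛ
    ; associator = λ _ _ _ → graph Prod.assocʳ
    ; unitorˡ = λ _ → graph proj₂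
    ; unitorʳ = λ _ → graph proj₁
    }

  Trisk-⊕ : MonoidalData Trisk
  Trisk-⊕ = record
    { _⊗₀_ = _⊎ₛ_
    ; _⊗₁_ = λ X Y → record
      { E = E X ⊎ₛ E Y
      ; s = Sum.map (s X) (s Y)
      ; t = Sum.map (t X) (t Y)
      ; w = [ w X , w Y ]′
      }
    ; ⊗₁-cong = λ φ ψ → record
      { edges = edges φ ⊎-↔ edges ψ
      ; s-≡ = [ (λ e → cong inj₁ (s-≡ φ e)) , (λ e → cong inj₂ (s-≡ ψ e)) ]
      ; t-≡ = [ (λ e → cong inj₁ (t-≡ φ e)) , (λ e → cong inj₂ (t-≡ ψ e)) ]
      ; w-≈ = [ w-≈ φ , w-≈ ψ ]
      }
    ; unit = ⊥ₛ
    ; associator = λ _ _ _ → graph Sum.assocʳ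
    ; unitorˡ = λ _ → graph [ (λ ()) , (λ x → x) ]′
    ; unitorʳ = λ _ → graph [ (λ x → x) , (λ ()) ]′
    }

  Matrix : Set<κ → Set<κ → Set (i ⊔ c)
  Matrix A B = ∣ A ∣ → ∣ B ∣ → Carrier

  infix 4 _≋_

  _≋_ : ∀ {A B} → Matrix A B → Matrix A B → Set (i ⊔ ℓ)
  M ≋ N = ∀ a b → M a b ≈ N a b

  graphMatrix : ∀ {A B} → (∣ A ∣ → ∣ B ∣) → Matrix A B
  graphMatrix f a b = if does (em {P = f a ≡ b}) then 1# else 0#

  graphMatrix-≡ : ∀ {A B} (f : ∣ A ∣ → ∣ B ∣) {a b} → f a ≡ b → graphMatrix {A} {B} f a b ≈ 1#
  graphMatrix-≡ f {a} {b} eq with em {P = f a ≡ b}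
  ... | yes _ = Ω.refl
  ... | no neq = ⊥-elim (neq eq)

  graphMatrix-≢ : ∀ {A B} (f : ∣ A ∣ → ∣ B ∣) {a b} → f a ≢ b → graphMatrix {A} {B} f a b ≈ 0#
  graphMatrix-≢ f {a} {b} neq with em {P = f a ≡ b}
  ... | yes eq = ⊥-elim (neq eq)
  ... | no _ = Ω.refl

  identity : ∀ {A} → Matrix A A
  identity {A} = graphMatrix {A} {A} λ x → x

  product : ∀ {A B C} → Matrix A B → Matrix B C → Matrix A C
  product M N a c = ∑ λ b → M a b * N b c

  Rel : Category (lsuc i) (i ⊔ c) (i ⊔ ℓ)
  Rel = record
    { Obj = Set<κ
    ; Hom = Matrix
    ; _≈_ = λ {A} {B} → _≋_ {A} {B}
    ; id = λ {A} → identity {A}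
    ; _⨾_ = λ {A} {B} {C} → product {A} {B} {C}
    ; isEquiv = record
      { refl = λ _ _ → Ω.refl
      ; sym = λ p a b → Ω.sym (p a b)
      ; trans = λ p q a b → Ω.trans (p a b) (q a b)
      }
    ; ⨾-cong = λ p q a c → ∑-cong λ b → *-cong (p a b) (q b c)
    ; assoc = λ M N P a d → begin
        ∑ (λ c → ∑ (λ b → M a b * N b c) * P c d)     ≈⟨ ∑-cong (λ c → ∑-distribʳ (P c d) _) ⟩
        ∑ (λ c → ∑ (λ b → M a b * N b c * P c d))     ≈⟨ ∑-swap _ ⟩
        ∑ (λ b → ∑ (λ c → M a b * N b c * P c d))     ≈⟨ ∑-cong (λ b → ∑-cong λ c → *-assoc _ _ _) ⟩
        ∑ (λ b → ∑ (λ c → M a b * (N b c * P c d)))   ≈⟨ ∑-cong (λ b → ∑-distribˡ (M a b) _) ⟨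
        ∑ (λ b → M a b * ∑ (λ c → N b c * P c d))     ∎
    ; identityˡ = λ {A} M a b → Ω.trans
        (∑-supported _ a (λ _ → em) λ x x≢a →
          Ω.trans (*-congʳ (graphMatrix-≢ {A} {A} (λ x → x) (x≢a ∘ sym))) (zeroˡ _))
        (Ω.trans (*-congʳ (graphMatrix-≡ {A} {A} (λ x → x) refl)) (*-identityˡ _))
    ; identityʳ = λ {_} {B} M a b → Ω.trans
        (∑-supported _ b (λ _ → em) λ x x≢b →
          Ω.trans (*-congˡ (graphMatrix-≢ {B} {B} (λ x → x) x≢b)) (zeroʳ _))
        (Ω.trans (*-congˡ (graphMatrix-≡ {B} {B} (λ x → x) refl)) (*-identityʳ _))
    }
    where open ≈-Reasoning setoid

  blockDiagonal : ∀ {A B A′ B′} → Matrix A B → Matrix A′ B′ → Matrix (A ⊎ₛ A′) (B ⊎ₛ B′)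
  blockDiagonal M N (inj₁ a) (inj₁ b) = M a b
  blockDiagonal M N (inj₁ _) (inj₂ _) = 0#
  blockDiagonal M N (inj₂ _) (inj₁ _) = 0#
  blockDiagonal M N (inj₂ a) (inj₂ b) = N a b

  Rel-⊗ : MonoidalData Rel
  Rel-⊗ = record
    { _⊗₀_ = _×ₛ_
    ; _⊗₁_ = λ M N (a , a′) (b , b′) → M a b * N a′ b′
    ; ⊗₁-cong = λ p q (a , a′) (b , b′) → *-cong (p a b) (q a′ b′)
    ; unit = ⊤ₛ
    ; associator = λ A B C → graphMatrix {(A ×ₛ B) ×ₛ C} {A ×ₛ (B ×ₛ C)} Prod.assocʳ
    ; unitorˡ = λ A → graphMatrix {⊤ₛ ×ₛ A} {A} proj₂
    ; unitorʳ = λ A → graphMatrix {A ×ₛ ⊤ₛ} {A} proj₁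
    }

  Rel-⊕ : MonoidalData Rel
  Rel-⊕ = record
    { _⊗₀_ = _⊎ₛ_
    ; _⊗₁_ = λ {A} {B} {A′} {B′} → blockDiagonal {A} {B} {A′} {B′}
    ; ⊗₁-cong = λ where
        p q (inj₁ a) (inj₁ b) → p a b
        p q (inj₁ _) (inj₂ _) → Ω.refl
        p q (inj₂ _) (inj₁ _) → Ω.refl
        p q (inj₂ a) (inj₂ b) → q a b
    ; unit = ⊥ₛ
    ; associator = λ A B C → graphMatrix {(A ⊎ₛ B) ⊎ₛ C} {A ⊎ₛ (B ⊎ₛ C)} Sum.assocʳ
    ; unitorˡ = λ A → graphMatrix {⊥ₛ ⊎ₛ A} {A} [ (λ ()) , (λ x → x) ]′
    ; unitorʳ = λ A → graphMatrix {A ⊎ₛ ⊥ₛ} {A} [ (λ x → x) , (λ ()) ]′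
    }

  𝒞 : ∀ {A B} → Triskell A B → Matrix A B
  𝒞 X a b = ∑ {Σ[ e ∈ ∣ E X ∣ ] (s X e ≡ a × t X e ≡ b)} λ (e , _) → w X e

{-# OPTIONS --safe #-}
-- An entry of a contraction is the sum of the weights over the fibre of (s , t), so each law
-- comes from a weight-preserving bijection between fibres.  A product of two entries becomes a
-- single sum over pairs of edges by distributivity.  The structural morphisms are graphs of
-- functions, whose fibres have at most one edge.
module Submission where

open import Axiom.ExcludedMiddle using (ExcludedMiddle)
open import Axiom.Extensionality.Propositional using (Extensionality)
open import Axiom.UniquenessOfIdentityProofs.WithK using (uip)
open import Data.Product.Base using (Σ-syntax; _×_; _,_; proj₁; proj₂)
open import Data.Sum.Base using (inj₁; inj₂)
open import Data.Sum.Properties using (inj₁-injective; inj₂-injective)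
open import Function.Bundles using (_↔_; mk↔ₛ′; Inverse)
open import Relation.Binary.PropositionalEquality using (_≡_; refl; sym; trans; cong; cong₂)
import Relation.Binary.Reasoning.Setoid as ≈-Reasoning
open import Relation.Nullary using (yes; no)
open import Defs

module _ {c ℓ i} (Ω : CompleteSemiring c ℓ i) where
  open CompleteSemiring Ω hiding (refl; sym; trans; zero)
  private module Ω = CompleteSemiring Ω
  open SumProperties Ω

  ∑-reindex : ∀ {I J : Set i} (φ : I ↔ J) {f : I → Carrier} {g : J → Carrier} →
              (∀ x → f x ≈ g (Inverse.to φ x)) → ∑ f ≈ ∑ g
  ∑-reindex φ {g = g} p = Ω.trans (∑-cong p) (∑-↔ φ g)

  -- Distributing `∑ g` from the right and then each `f x` from the left keeps every `f x` to the
  -- left of every `g y`.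
  ∑-*-∑ : ∀ {I J : Set i} (f : I → Carrier) (g : J → Carrier) →
          ∑ f * ∑ g ≈ ∑ {I × J} λ (x , y) → f x * g y
  ∑-*-∑ {I} {J} f g = begin
    ∑ f * ∑ g                           ≈⟨ ∑-distribʳ (∑ g) f ⟩
    ∑ (λ x → f x * ∑ g)                 ≈⟨ ∑-cong (λ x → ∑-distribˡ (f x) g) ⟩
    ∑ (λ x → ∑ λ y → f x * g y)         ≈⟨ ∑-× _ ⟨
    ∑ {I × J} (λ (x , y) → f x * g y)   ∎
    where open ≈-Reasoning setoid

module ContractionProperties
  (em : ∀ {a} → ExcludedMiddle a)
  (ext : ∀ {a b} → Extensionality a b)
  {i c ℓ} (κ : Set i) (ℵ₁≤κ : ℵ₁≤ κ)
  (Ω : CompleteSemiring c ℓ i)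
  where

  open CompleteSemiring Ω hiding (refl; sym; trans; zero)
  private module Ω = CompleteSemiring Ω
  open SumProperties Ω
  open Contraction em ext κ ℵ₁≤κ Ω
  open Set<κ using (∣_∣)
  open Triskell
  private
    module ⊗ = MonoidalData Trisk-⊗
    module ⊕ = MonoidalData Trisk-⊕
    module ⊗ᴿ = MonoidalData Rel-⊗
    module ⊕ᴿ = MonoidalData Rel-⊕

  Fibre : ∀ {A B} → Triskell A B → ∣ A ∣ → ∣ B ∣ → Set i
  Fibre X a b = Σ[ e ∈ ∣ E X ∣ ] (s X e ≡ a × t X e ≡ b)

  -- The two equations are unique by `uip`, so the edge determines the element. This settles most
  -- round trips of the bijections below.
  Fibre-≡ : ∀ {A B} {X : Triskell A B} {a b} {x y : Fibre X a b} → proj₁ x ≡ proj₁ y → x ≡ y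
  Fibre-≡ {x = _ , p , q} {_ , p′ , q′} refl = cong (_ ,_) (cong₂ _,_ (uip p p′) (uip q q′))

  -- Makes `𝒞` well defined on isomorphism classes: an isomorphism respects sources and targets, so
  -- it restricts to each fibre.
  𝒞-cong : ∀ {A B} {X Y : Triskell A B} → X ≅ Y → _≋_ {A} {B} (𝒞 X) (𝒞 Y)
  𝒞-cong {X = X} {Y} φ a b = ∑-reindex Ω fibres λ (e , _) → w-≈ e
    where
    open _≅_ φ
    fibres : Fibre X a b ↔ Fibre Y a b
    fibres = mk↔ₛ′
      (λ (e , p , q) → to e , trans (sym (s-≡ e)) p , trans (sym (t-≡ e)) q)
      (λ (e , p , q) → from e
        , trans (s-≡ (from e)) (trans (cong (s Y) (strictlyInverseˡ e)) p)
        , trans (t-≡ (from e)) (trans (cong (t Y) (strictlyInverseˡ e)) q))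
      (λ (e , _) → Fibre-≡ {X = Y} (strictlyInverseˡ e))
      (λ (e , _) → Fibre-≡ {X = X} (strictlyInverseʳ e))

  -- The edges are the elements of `A` with themselves as sources, so only `a` can lie over
  -- `(a , b)`, and it does exactly when `f a ≡ b`. Covers identities and all structural morphisms.
  𝒞-graph : ∀ {A B} (f : ∣ A ∣ → ∣ B ∣) → _≋_ {A} {B} (𝒞 (graph {A} {B} f)) (graphMatrix {A} {B} f)
  -- The same decision occurs in `graphMatrix`, so each branch reduces the right-hand side to `1#`
  -- or `0#`.
  𝒞-graph {A} {B} f a b with em {P = f a ≡ b}
  ... | yes eq = ∑-singleton _ (a , refl , eq) λ (_ , p , _) → Fibre-≡ {X = graph {A} {B} f} p
  ... | no neq = ∑-empty _ λ { (_ , refl , q) → neq q }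

  -- Sorting composable pairs by the vertex `b` where they meet splits the fibre into a disjoint
  -- union over `b` of products of fibres.
  𝒞-compose : ∀ {A B C} (X : Triskell A B) (Y : Triskell B C) →
              _≋_ {A} {C} (𝒞 (compose X Y)) (product {A} {B} {C} (𝒞 X) (𝒞 Y))
  𝒞-compose {B = B} X Y a c = begin
    𝒞 (compose X Y) a c
      ≈⟨ ∑-reindex Ω fibres (λ _ → Ω.refl) ⟩
    ∑ {Σ[ b ∈ ∣ B ∣ ] (Fibre X a b × Fibre Y b c)} (λ (_ , (e , _) , (e′ , _)) → w X e * w Y e′)
      ≈⟨ ∑-Σ _ ⟩
    ∑ (λ b → ∑ {Fibre X a b × Fibre Y b c} λ ((e , _) , (e′ , _)) → w X e * w Y e′)
      ≈⟨ ∑-cong (λ b → ∑-*-∑ Ω _ _) ⟨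
    ∑ (λ b → 𝒞 X a b * 𝒞 Y b c) ∎
    where
    open ≈-Reasoning setoid
    fibres : Fibre (compose X Y) a c ↔ (Σ[ b ∈ ∣ B ∣ ] (Fibre X a b × Fibre Y b c))
    fibres = mk↔ₛ′
      (λ (((e , e′) , eq) , p , q) → t X e , (e , p , refl) , (e′ , sym eq , q))
      (λ (_ , (e , p , q) , (e′ , p′ , q′)) → ((e , e′) , trans q (sym p′)) , p , q′)
      -- Matching on `refl` turns the middle vertex into `t X e`; only the proof that `e′` starts
      -- there may differ.
      (λ { (_ , (e , p , refl) , (e′ , p′ , q′)) →
           cong (λ r → _ , (e , p , refl) , (e′ , r , q′)) (uip _ _) })
      -- An edge of the composite itself carries an equation, hence the inner `Σ-≡`.
      (λ _ → Fibre-≡ {X = compose X Y} (Σ-≡ refl))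

  -- An equation between pairs is a pair of equations, so the fibre is a product of fibres.
  𝒞-⊗ : ∀ {A B A′ B′} (X : Triskell A B) (Y : Triskell A′ B′) →
        _≋_ {A ×ₛ A′} {B ×ₛ B′} (𝒞 (X ⊗.⊗₁ Y)) (⊗ᴿ._⊗₁_ {A} {B} {A′} {B′} (𝒞 X) (𝒞 Y))
  𝒞-⊗ X Y (a , a′) (b , b′) =
    Ω.trans (∑-reindex Ω fibres λ _ → Ω.refl) (Ω.sym (∑-*-∑ Ω _ _))
    where
    fibres : Fibre (X ⊗.⊗₁ Y) (a , a′) (b , b′) ↔ (Fibre X a b × Fibre Y a′ b′)
    fibres = mk↔ₛ′
      (λ ((e , e′) , p , q) → (e , cong proj₁ p , cong proj₁ q) , (e′ , cong proj₂ p , cong proj₂ q))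
      (λ ((e , p , q) , (e′ , p′ , q′)) → (e , e′) , cong₂ _,_ p p′ , cong₂ _,_ q q′)
      (λ _ → cong₂ _,_ (Fibre-≡ {X = X} refl) (Fibre-≡ {X = Y} refl))
      (λ _ → Fibre-≡ {X = X ⊗.⊗₁ Y} refl)

  -- Each edge has both ends in its own summand: a diagonal fibre comes from one triskell, an
  -- off-diagonal one is empty.
  𝒞-⊕ : ∀ {A B A′ B′} (X : Triskell A B) (Y : Triskell A′ B′) →
        _≋_ {A ⊎ₛ A′} {B ⊎ₛ B′} (𝒞 (X ⊕.⊗₁ Y)) (blockDiagonal {A} {B} {A′} {B′} (𝒞 X) (𝒞 Y))
  𝒞-⊕ X Y (inj₁ a) (inj₁ b) = ∑-reindex Ω fibres λ { (inj₁ _ , _) → Ω.refl ; (inj₂ _ , () , _) }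
    where
    fibres : Fibre (X ⊕.⊗₁ Y) (inj₁ a) (inj₁ b) ↔ Fibre X a b
    fibres = mk↔ₛ′
      (λ { (inj₁ e , p , q) → e , inj₁-injective p , inj₁-injective q ; (inj₂ _ , () , _) })
      (λ (e , p , q) → inj₁ e , cong inj₁ p , cong inj₁ q)
      (λ _ → Fibre-≡ {X = X} refl)
      (λ { (inj₁ _ , _) → Fibre-≡ {X = X ⊕.⊗₁ Y} refl ; (inj₂ _ , () , _) })
  𝒞-⊕ X Y (inj₁ _) (inj₂ _) = ∑-empty _ λ { (inj₁ _ , _ , ()) ; (inj₂ _ , () , _) }
  𝒞-⊕ X Y (inj₂ _) (inj₁ _) = ∑-empty _ λ { (inj₁ _ , () , _) ; (inj₂ _ , _ , ()) }
  𝒞-⊕ X Y (inj₂ a) (inj₂ b) = ∑-reindex Ω fibres λ { (inj₂ _ , _) → Ω.refl ; (inj₁ _ , () , _) }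
    where
    fibres : Fibre (X ⊕.⊗₁ Y) (inj₂ a) (inj₂ b) ↔ Fibre Y a b
    fibres = mk↔ₛ′
      (λ { (inj₂ e , p , q) → e , inj₂-injective p , inj₂-injective q ; (inj₁ _ , () , _) })
      (λ (e , p , q) → inj₂ e , cong inj₂ p , cong inj₂ q)
      (λ _ → Fibre-≡ {X = Y} refl)
      (λ { (inj₂ _ , _) → Fibre-≡ {X = X ⊕.⊗₁ Y} refl ; (inj₁ _ , () , _) })

  𝒞-isFunctor : IsFunctor Trisk Rel (λ A → A) 𝒞
  𝒞-isFunctor = record
    { F₁-cong = 𝒞-cong
    ; F₁-id = λ {A} → 𝒞-graph {A} {A} λ x → x
    ; F₁-⨾ = 𝒞-compose
    }

  𝒞-isStrictMonoidal-⊗ : IsStrictMonoidalFunctor Trisk-⊗ Rel-⊗ (λ A → A) 𝒞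
  𝒞-isStrictMonoidal-⊗ = record
    { isFunctor = 𝒞-isFunctor
    -- Both categories have the same objects and the same tensor on them, so every `cast` computes
    -- away.
    ; F-⊗₀ = λ _ _ → refl
    ; F-unit = refl
    ; F-⊗₁ = 𝒞-⊗
    ; F-associator = λ A B C → 𝒞-graph {(A ×ₛ B) ×ₛ C} {A ×ₛ (B ×ₛ C)} _
    ; F-unitorˡ = λ A → 𝒞-graph {⊤ₛ ×ₛ A} {A} _
    ; F-unitorʳ = λ A → 𝒞-graph {A ×ₛ ⊤ₛ} {A} _
    }

  𝒞-isStrictMonoidal-⊕ : IsStrictMonoidalFunctor Trisk-⊕ Rel-⊕ (λ A → A) 𝒞
  𝒞-isStrictMonoidal-⊕ = record
    { isFunctor = 𝒞-isFunctor
    ; F-⊗₀ = λ _ _ → refl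
    ; F-unit = refl
    ; F-⊗₁ = 𝒞-⊕
    -- The structural morphisms on both sides come from the same functions.
    ; F-associator = λ A B C → 𝒞-graph {(A ⊎ₛ B) ⊎ₛ C} {A ⊎ₛ (B ⊎ₛ C)} _
    ; F-unitorˡ = λ A → 𝒞-graph {⊥ₛ ⊎ₛ A} {A} _
    ; F-unitorʳ = λ A → 𝒞-graph {A ⊎ₛ ⊥ₛ} {A} _
    }

theorem14 : ∀ {i c ℓ}
    (em : ∀ {a} → ExcludedMiddle a)
    (ext : ∀ {a b} → Extensionality a b)
    (κ : Set i) (ℵ₁≤κ : ℵ₁≤ κ)
    (Ω : CompleteSemiring c ℓ i) →
    let open Contraction em ext κ ℵ₁≤κ Ω in
    IsStrictMonoidalFunctor Trisk-⊗ Rel-⊗ (λ A → A) 𝒞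
    × IsStrictMonoidalFunctor Trisk-⊕ Rel-⊕ (λ A → A) 𝒞
theorem14 em ext κ ℵ₁≤κ Ω = 𝒞-isStrictMonoidal-⊗ , 𝒞-isStrictMonoidal-⊕
  where open ContractionProperties em ext κ ℵ₁≤κ Ω
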